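{- Let $\mathbf{B}$ be a connected bidirected graph, $q:=q_{\mathbf{B}}$, and $\mathcal{R}^{\rm inc}_{\mathbf{B}}:=\{\pm\mathrm{inc}(\omega):\omega\in\mathfrak{w}(\mathbf{B})\}\subseteq\mathbb{Z}^{|E(\mathbf{B})|}$. Then $$\mathcal{R}_q(0)\cup\mathcal{R}_q(1)\subseteq\mathcal{R}^{\rm inc}_{\mathbf{B}}\subseteq\mathcal{R}_q(0)\cup\mathcal{R}_q(1)\cup\mathcal{R}_q(2).$$ Moreover: (a) $\mathcal{R}_q(0)=\{\pm\mathrm{inc}(\omega):\omega\in\mathfrak{w}(\mathbf{B})$ a closed walk with an even number of bidirected arrows$\}$; (b) $\mathcal{R}_q(1)=\{\pm\mathrm{inc}(\omega):\omega\in\mathfrak{w}(\mathbf{B})$ an open walk$\}$; (c) $\mathcal{R}^{\rm inc}_{\mathbf{B}}\cap\mathcal{R}_q(2)=\{\pm\mathrm{inc}(\omega):\omega\in\mathfrak{w}(\mathbf{B})$ a closed walk with an odd number of bidirected arrows$\}$; (d) $\mathcal{R}_q(0)\cup\mathcal{R}_q(1)=\mathcal{R}^{\rm inc}_{\mathbf{B}}$ if and only if $\mathbf{B}$ is balanced.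
   Context: A bidirected graph $\mathbf{B}$: finite sets $V(\mathbf{B})$, $E(\mathbf{B})=\{1,\dots,n\}\ne\emptyset$, and for each arrow $i$ a multiset $\mathbbm{v}(i)=\{(u,\epsilon),(u',\epsilon')\}\subset V(\mathbf{B})\times\{\pm1\}$; $i$ is directed if $\epsilon\ne\epsilon'$, bidirected if $\epsilon=\epsilon'$, a loop if $u=u'$; its sign is $\sigma(i)=-\epsilon\epsilon'$. Incidence matrix: $I(\mathbf{B})^Te_i=\epsilon e_u+\epsilon'e_{u'}$; incidence form $q_{\mathbf{B}}(x)=\frac12x^TI(\mathbf{B})I(\mathbf{B})^Tx$, $x\in\mathbb{Z}^n$. $\mathcal{R}_q(d)=\{x\in\mathbb{Z}^n:q(x)=d\}$. Connected means underlying multigraph connected. Add a formal inverse $i^{ -1}$ for each directed loop $i$, with the same endpoints and sign. A walk $\omega=(v_0,i_1,v_1,\dots,i_\ell,v_\ell)$ is a sequence where each $i_t$ is an arrow or formal inverse with endpoint set $\{v_{t-1},v_t\}$; $\mathfrak{w}(\mathbf{B})$ is the set of walks; $\omega$ is closed if $v_0=v_\ell$, open otherwise; $\sigma(\omega)=\prod\sigma(i_t)$ ($=1$ for length $0$). Define $d(v,i)=d$ if $(v,d)\in\mathbbm{v}(i)$ and $(v,-d)\notin\mathbbm{v}(i)$; $d(v,i)=+1$ if $i$ is a directed loop at $v$; $d(v,i^{ -1})=-1$ for a formal inverse of a directed loop at $v$; $d(v,i)=0$ otherwise. Then $\mathrm{inc}(\omega)=\sum_{t=1}^{\ell}\sigma(\omega^{[t-1]})\,d(v_{t-1},i_t)\,e_{i_t}$,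 where $\omega^{[t]}$ is the initial subwalk of length $t$ and $e_{i^{ -1}}:=e_i$. $\mathbf{B}$ is balanced if every closed walk has an even number of bidirected arrows. -}

module Defs where

open import Data.Nat as ℕ using (ℕ; zero; suc)
open import Data.Nat.Divisibility using (_∣_)
open import Data.Integer as ℤ using (ℤ; +_; -_; _+_; _*_)
open import Data.Sign as S using (Sign)
open import Data.Fin using (Fin; zero; suc; _≟_)
open import Data.Bool using (Bool; true; false; if_then_else_; _∧_; _∨_; not)
open import Data.Product using (_×_; _,_; proj₁; proj₂; ∃; ∃-syntax; Σ)
open import Data.Sum using (_⊎_)
open import Relation.Binary.PropositionalEquality using (_≡_; _≢_)
open import Relation.Nullary.Decidable using (⌊_⌋)
open import Relation.Nullary using (¬_)

------------------------------------------------------------------------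
-- Bidirected graphs with vertex set Fin m and arrow set Fin n.
-- Each arrow i carries the multiset v(i) = {(u,ε),(u',ε')}, stored
-- as an (arbitrarily) ordered pair.

record BGraph (m n : ℕ) : Set where
  field
    ends : Fin n → (Fin m × Sign) × (Fin m × Sign)

module _ {m n : ℕ} (B : BGraph m n) where
  open BGraph B

  src : Fin n → Fin m
  src i = proj₁ (proj₁ (ends i))
  tgt : Fin n → Fin m
  tgt i = proj₁ (proj₂ (ends i))
  εs : Fin n → Sign
  εs i = proj₂ (proj₁ (ends i))
  εt : Fin n → Sign
  εt i = proj₂ (proj₂ (ends i))

  -- sign σ(i) = - ε ε'
  σ : Fin n → Sign
  σ i = S.opposite (εs i S.* εt i)

  isDirected : Fin n → Bool
  isDirected i = not ⌊ εs i S.≟ εt i ⌋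

  isBidirected : Fin n → Bool
  isBidirected i = ⌊ εs i S.≟ εt i ⌋

  -- i is a loop at v
  isLoopAt : Fin m → Fin n → Bool
  isLoopAt v i = ⌊ src i ≟ v ⌋ ∧ ⌊ tgt i ≟ v ⌋

  isDirLoopAt : Fin m → Fin n → Bool
  isDirLoopAt v i = isLoopAt v i ∧ isDirected i

  isDirLoop : Fin n → Bool
  isDirLoop i = ⌊ src i ≟ tgt i ⌋ ∧ isDirected i

  -- (v , s) ∈ v(i)
  mem : Fin m → Sign → Fin n → Bool
  mem v s i = (⌊ src i ≟ v ⌋ ∧ ⌊ εs i S.≟ s ⌋) ∨ (⌊ tgt i ≟ v ⌋ ∧ ⌊ εt i S.≟ s ⌋)

  -- Letters: arrows and formal inverses (of directed loops only; see Step)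
  data Letter : Set where
    fwd : Fin n → Letter
    inv : Fin n → Letter

  arrowOf : Letter → Fin n
  arrowOf (fwd i) = i
  arrowOf (inv i) = i

  -- the endpoint (multi)set of the letter is {v , w}
  EndsAre : Letter → Fin m → Fin m → Set
  EndsAre a v w = (src (arrowOf a) ≡ v × tgt (arrowOf a) ≡ w)
                ⊎ (src (arrowOf a) ≡ w × tgt (arrowOf a) ≡ v)

  -- a letter may be used as a step from v to w
  Step : Letter → Fin m → Fin m → Set
  Step (fwd i) v w = EndsAre (fwd i) v w
  Step (inv i) v w = isDirLoop i ≡ true × EndsAre (inv i) v w

  σL : Letter → Sign
  σL a = σ (arrowOf a)

  -- walks from v to w
  data Walk : Fin m → Fin m → Set where
    []  : (v : Fin m) → Walk v v
    _∷_ : {v w z : Fin m} → (Σ Letter λ a → Step a v w) → Walk w z → Walk v z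

  sgnℤ : Sign → ℤ
  sgnℤ S.+ = + 1
  sgnℤ S.- = - (+ 1)

  -- d(v , a)
  dfun : Fin m → Letter → ℤ
  dfun v (fwd i) =
    if isDirLoopAt v i then + 1
    else if mem v S.+ i ∧ not (mem v S.- i) then + 1
    else if mem v S.- i ∧ not (mem v S.+ i) then - (+ 1)
    else + 0
  dfun v (inv i) = if isDirLoopAt v i then - (+ 1) else + 0

  Vecℤ : Set
  Vecℤ = Fin n → ℤ

  zeroV : Vecℤ
  zeroV _ = + 0

  unit : Fin n → Vecℤ
  unit i j = if ⌊ i ≟ j ⌋ then + 1 else + 0

  _+V_ : Vecℤ → Vecℤ → Vecℤ
  (x +V y) j = x j + y j

  _·V_ : ℤ → Vecℤ → Vecℤ
  (c ·V x) j = c * x j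

  negV : Vecℤ → Vecℤ
  negV x j = - x j

  -- incFrom s ω = Σ_t s·σ(ω^[t-1]) d(v_{t-1},i_t) e_{i_t}
  -- (s is the accumulated sign of the already-traversed prefix)
  incFrom : {v w : Fin m} → Sign → Walk v w → Vecℤ
  incFrom s ([] v) = zeroV
  incFrom {v} s ((a , _) ∷ ω) =
    ((sgnℤ s * dfun v a) ·V unit (arrowOf a)) +V incFrom (s S.* σL a) ω

  inc : {v w : Fin m} → Walk v w → Vecℤ
  inc = incFrom S.+

  -- number of bidirected arrows traversed by a walk
  nBidir : {v w : Fin m} → Walk v w → ℕ
  nBidir ([] v) = 0
  nBidir ((fwd i , _) ∷ ω) = (if isBidirected i then 1 else 0) ℕ.+ nBidir ω
  nBidir ((inv i , _) ∷ ω) = (if isBidirected i then 1 else 0) ℕ.+ nBidir ω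

  EvenBidir : {v w : Fin m} → Walk v w → Set
  EvenBidir ω = 2 ∣ nBidir ω

  Balanced : Set
  Balanced = ∀ (v : Fin m) (ω : Walk v v) → EvenBidir ω

  -- connectivity of the underlying multigraph
  data Reach : Fin m → Fin m → Set where
    here : (v : Fin m) → Reach v v
    step : {v w z : Fin m} (i : Fin n) → EndsAre (fwd i) v w → Reach w z → Reach v z

  Connected : Set
  Connected = ∀ (u v : Fin m) → Reach u v

  -- incidence matrix entry I(B)_{i v}: coefficient of e_v in ε e_u + ε' e_{u'}
  Inc : Fin n → Fin m → ℤ
  Inc i v = (if ⌊ src i ≟ v ⌋ then sgnℤ (εs i) else + 0)
          + (if ⌊ tgt i ≟ v ⌋ then sgnℤ (εt i) else + 0)

  Σℤ : {k : ℕ} → (Fin k → ℤ) → ℤ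
  Σℤ {zero} f = + 0
  Σℤ {suc k} f = f zero + Σℤ (λ j → f (suc j))

  -- x^T I(B) I(B)^T x  =  2 q_B(x)
  twoQ : Vecℤ → ℤ
  twoQ x = Σℤ λ v → (Σℤ λ i → Inc i v * x i) * (Σℤ λ i → Inc i v * x i)

  -- x ∈ R_q(d)  iff  q_B(x) = d  iff  x^T I I^T x = 2 d
  Rq : ℕ → Vecℤ → Set
  Rq d x = twoQ x ≡ + (2 ℕ.* d)

  -- x = ± inc(ω) (pointwise)
  PMInc : {v w : Fin m} → Walk v w → Vecℤ → Set
  PMInc ω x = (∀ j → x j ≡ inc ω j) ⊎ (∀ j → x j ≡ - inc ω j)

  -- x ∈ R^inc_B
  InRinc : Vecℤ → Set
  InRinc x = ∃[ v ] ∃[ w ] Σ (Walk v w) λ ω → PMInc ω x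

-- The boundary map x ↦ I(B)ᵀx sends the incidence vector of a walk from a to b, read with starting
-- sign s, to s (e_a − τ e_b), where τ is the product of the signs of its arrows: a step along i from v
-- to w contributes d(v,i) I(B)ᵀe_i = e_v − σ(i) e_w, and these telescope. Since 2q(x) = |I(B)ᵀx|²,
-- the vector of an open walk has q = 1, and that of a closed walk has q = 0 or q = 2 according as
-- τ = +1 or −1, that is, as it uses an even or an odd number of bidirected arrows.
-- Conversely, q(x) ≤ 1 forces I(B)ᵀx = 0 or ± e_a ± e_b with a ≠ b, which is again of the shape
-- s (e_a − τ e_b), and such an x is realised by induction on ‖x‖₁: the value of I(B)ᵀx at a singles
-- out an arrow at a along which a first step lowers ‖x‖₁. If I(B)ᵀx = 0 the closed walk may start
-- at an endpoint of any arrow in the support of x, and connectivity lets it be moved to any vertex by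
-- going out along a path and coming back.

module Submission where

open import Defs
open import Data.Bool using (true; false; if_then_else_)
open import Data.Fin using (Fin; zero; suc; _≟_)
import Data.Fin.Properties as FinP
open import Data.Integer as ℤ
  using (ℤ; +_; -_; _+_; _*_; _-_; +[1+_]; -[1+_]; _◃_; +≤+; +<+)
import Data.Integer.Properties as ℤP
open import Data.Integer.Tactic.RingSolver using (solve-∀)
open import Data.Nat as ℕ using (ℕ; zero; suc; _<_)
import Data.Nat.Properties as ℕP
open import Data.Nat.Divisibility using (_∣_)
import Data.Nat.Divisibility as ND
open import Data.Product using (_×_; _,_; proj₁; proj₂; ∃; ∃-syntax; Σ)
open import Data.Sign as S using (Sign)
import Data.Sign.Properties as SP
open import Data.Sum using (_⊎_; inj₁; inj₂; [_,_]′; swap)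
open import Function using (_∘_; case_of_)
open import Function.Bundles using (_⇔_; mk⇔; Equivalence)
open import Relation.Binary.Definitions using (tri<; tri≈; tri>)
open import Relation.Binary.PropositionalEquality
open import Relation.Nullary using (¬_; yes; no; contradiction)
open import Relation.Nullary.Decidable using (⌊_⌋; _×-dec_)
open import Algebra.Properties.Semiring.Sum ℤP.+-*-semiring
  using (sum; sum-cong-≗; ∑-distrib-+; *-distribˡ-sum; sum-replicate-zero)

-- Kronecker delta and finite sums

δ : {k : ℕ} → Fin k → Fin k → ℤ
δ a v = if ⌊ a ≟ v ⌋ then + 1 else + 0

δ-refl : {k : ℕ} (a : Fin k) → δ a a ≡ + 1
δ-refl a with a ≟ a
... | yes _ = refl
... | no a≢a = contradiction refl a≢a

δ-suc : {k : ℕ} (a v : Fin k) → δ (suc a) (suc v) ≡ δ a v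
δ-suc a v with a ≟ v
... | yes _ = refl
... | no _ = refl

if-≟-δ : {k : ℕ} (a v : Fin k) (c : ℤ) → (if ⌊ a ≟ v ⌋ then c else + 0) ≡ c * δ a v
if-≟-δ a v c with a ≟ v
... | yes _ = sym (ℤP.*-identityʳ c)
... | no _ = sym (ℤP.*-zeroʳ c)

sum-δ-select : {k : ℕ} (g : Fin k → ℤ) (a : Fin k) → sum (λ v → g v * δ a v) ≡ g a
sum-δ-select {suc k} g zero = begin
  g zero * + 1 + sum (λ v → g (suc v) * + 0)
    ≡⟨ cong₂ _+_ (ℤP.*-identityʳ (g zero)) (sum-cong-≗ (ℤP.*-zeroʳ ∘ g ∘ suc)) ⟩
  g zero + sum {k} (λ _ → + 0)
    ≡⟨ cong (_+_ (g zero)) (sum-replicate-zero k) ⟩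
  g zero + + 0
    ≡⟨ ℤP.+-identityʳ (g zero) ⟩
  g zero ∎
  where open ≡-Reasoning
sum-δ-select {suc k} g (suc a) = begin
  g zero * + 0 + sum (λ v → g (suc v) * δ (suc a) (suc v))
    ≡⟨ cong₂ _+_ (ℤP.*-zeroʳ (g zero)) (sum-cong-≗ (λ v → cong (g (suc v) *_) (δ-suc a v))) ⟩
  + 0 + sum (λ v → g (suc v) * δ a v)
    ≡⟨ ℤP.+-identityˡ _ ⟩
  sum (λ v → g (suc v) * δ a v)
    ≡⟨ sum-δ-select (g ∘ suc) a ⟩
  g (suc a) ∎
  where open ≡-Reasoning

sum-δ : {k : ℕ} (a : Fin k) → sum (δ a) ≡ + 1
sum-δ a = trans (sum-cong-≗ (λ v → sym (ℤP.*-identityˡ (δ a v)))) (sum-δ-select (λ _ → + 1) a)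

sum-nonpos : {k : ℕ} (f : Fin k → ℤ) → (∀ j → f j ℤ.≤ + 0) → sum f ℤ.≤ + 0
sum-nonpos {zero} f _ = ℤP.≤-refl
sum-nonpos {suc k} f f≤0 = ℤP.+-mono-≤ (f≤0 zero) (sum-nonpos (f ∘ suc) (f≤0 ∘ suc))

sum-neg : {k : ℕ} (f : Fin k → ℤ) (i : Fin k) → (∀ j → f j ℤ.≤ + 0) → f i ℤ.< + 0 → sum f ℤ.< + 0
sum-neg f zero f≤0 fi<0 = ℤP.+-mono-<-≤ fi<0 (sum-nonpos (f ∘ suc) (f≤0 ∘ suc))
sum-neg f (suc i) f≤0 fi<0 = ℤP.+-mono-≤-< (f≤0 zero) (sum-neg (f ∘ suc) i (f≤0 ∘ suc) fi<0)

nonpos-or-positive : {k : ℕ} (f : Fin k → ℤ) → (∀ j → f j ℤ.≤ + 0) ⊎ ∃ λ j → + 0 ℤ.< f j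
nonpos-or-positive f with FinP.any? (λ j → + 0 ℤ.<? f j)
... | yes pos = inj₂ pos
... | no ¬pos = inj₁ (λ j → ℤP.≮⇒≥ (λ 0<fj → ¬pos (j , 0<fj)))

positive-term-of-positive-sum : {k : ℕ} (f : Fin k → ℤ) → + 0 ℤ.< sum f → ∃ λ j → + 0 ℤ.< f j
positive-term-of-positive-sum f 0<Σf with nonpos-or-positive f
... | inj₁ f≤0 = contradiction (sum-nonpos f f≤0) (ℤP.<⇒≱ 0<Σf)
... | inj₂ pos = pos

positive-term-of-zero-sum : {k : ℕ} (f : Fin k → ℤ) (i : Fin k) → sum f ≡ + 0 → f i ≢ + 0 →
                            ∃ λ j → + 0 ℤ.< f j
positive-term-of-zero-sum f i Σf≡0 fi≢0 with nonpos-or-positive f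
... | inj₁ f≤0 = contradiction (sum-neg f i f≤0 (ℤP.≤∧≢⇒< (f≤0 i) fi≢0)) (ℤP.<-irrefl Σf≡0)
... | inj₂ pos = pos

0≤i⇒0<i*j⇒0<j : {i j : ℤ} → + 0 ℤ.≤ i → + 0 ℤ.< i * j → + 0 ℤ.< j
0≤i⇒0<i*j⇒0<j {i} {j} 0≤i 0<ij =
  ℤP.*-cancelˡ-<-nonNeg i {{ℤ.nonNegative 0≤i}} (subst (ℤ._< i * j) (sym (ℤP.*-zeroʳ i)) 0<ij)

-- The ℓ¹ norm

‖_‖₁ : {k : ℕ} → (Fin k → ℤ) → ℕ
‖_‖₁ {zero} x = 0
‖_‖₁ {suc k} x = ℤ.∣ x zero ∣ ℕ.+ ‖ x ∘ suc ‖₁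

‖‖₁-cong : {k : ℕ} {x y : Fin k → ℤ} → (∀ j → x j ≡ y j) → ‖ x ‖₁ ≡ ‖ y ‖₁
‖‖₁-cong {zero} x≗y = refl
‖‖₁-cong {suc k} x≗y = cong₂ ℕ._+_ (cong ℤ.∣_∣ (x≗y zero)) (‖‖₁-cong (x≗y ∘ suc))

‖‖₁≡0⇒≗0 : {k : ℕ} (x : Fin k → ℤ) → ‖ x ‖₁ ≡ 0 → ∀ j → x j ≡ + 0
‖‖₁≡0⇒≗0 x ‖x‖≡0 zero = ℤP.∣i∣≡0⇒i≡0 (ℕP.m+n≡0⇒m≡0 _ ‖x‖≡0)
‖‖₁≡0⇒≗0 x ‖x‖≡0 (suc j) = ‖‖₁≡0⇒≗0 (x ∘ suc) (ℕP.m+n≡0⇒n≡0 ℤ.∣ x zero ∣ ‖x‖≡0) j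

≗0⇒‖‖₁≡0 : {k : ℕ} (x : Fin k → ℤ) → (∀ j → x j ≡ + 0) → ‖ x ‖₁ ≡ 0
≗0⇒‖‖₁≡0 {zero} x _ = refl
≗0⇒‖‖₁≡0 {suc k} x x≗0 = cong₂ ℕ._+_ (cong ℤ.∣_∣ (x≗0 zero)) (≗0⇒‖‖₁≡0 (x ∘ suc) (x≗0 ∘ suc))

‖‖₁-support : {k : ℕ} (x : Fin k → ℤ) {r : ℕ} → ‖ x ‖₁ ≡ suc r → ∃ λ j → x j ≢ + 0
‖‖₁-support {k} x ‖x‖≡1+r = FinP.¬∀⟶∃¬ k (λ j → x j ≡ + 0) (λ j → x j ℤ.≟ + 0)
  (λ x≗0 → ℕP.1+n≢0 (trans (sym ‖x‖≡1+r) (≗0⇒‖‖₁≡0 x x≗0)))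

∣i∣≡1+∣i-c∣ : (c i : ℤ) → c * c ≡ + 1 → + 0 ℤ.< c * i → ℤ.∣ i ∣ ≡ suc ℤ.∣ i - c ∣
∣i∣≡1+∣i-c∣ +[1+ zero ] (+ zero) _ (+<+ ())
∣i∣≡1+∣i-c∣ +[1+ zero ] +[1+ r ] _ _ = refl
∣i∣≡1+∣i-c∣ -[1+ zero ] -[1+ zero ] _ _ = refl
∣i∣≡1+∣i-c∣ -[1+ zero ] -[1+ suc r ] _ _ = refl
∣i∣≡1+∣i-c∣ +[1+ zero ] -[1+ r ] _ ()
∣i∣≡1+∣i-c∣ -[1+ zero ] (+ zero) _ (+<+ ())
∣i∣≡1+∣i-c∣ -[1+ zero ] +[1+ r ] _ ()
∣i∣≡1+∣i-c∣ (+ zero) _ () _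
∣i∣≡1+∣i-c∣ +[1+ suc n ] _ () _
∣i∣≡1+∣i-c∣ -[1+ suc n ] _ () _

i-j*0≡i : (i j : ℤ) → i - j * + 0 ≡ i
i-j*0≡i i j = trans (cong (λ w → i - w) (ℤP.*-zeroʳ j)) (ℤP.+-identityʳ i)

‖‖₁-descent : {k : ℕ} (x : Fin k → ℤ) (j : Fin k) (c : ℤ) → c * c ≡ + 1 → + 0 ℤ.< c * x j →
              ‖ x ‖₁ ≡ suc ‖ (λ i → x i - c * δ j i) ‖₁
‖‖₁-descent x zero c c²≡1 0<cxj = cong₂ ℕ._+_
  (trans (∣i∣≡1+∣i-c∣ c (x zero) c²≡1 0<cxj) (cong (λ c′ → suc ℤ.∣ x zero - c′ ∣) (sym (ℤP.*-identityʳ c))))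
  (‖‖₁-cong (λ i → sym (i-j*0≡i (x (suc i)) c)))
‖‖₁-descent x (suc j) c c²≡1 0<cxj = begin
  ℤ.∣ x zero ∣ ℕ.+ ‖ x ∘ suc ‖₁
    ≡⟨ cong₂ ℕ._+_ (cong ℤ.∣_∣ (sym (i-j*0≡i (x zero) c))) (‖‖₁-descent (x ∘ suc) j c c²≡1 0<cxj) ⟩
  ℤ.∣ x zero - c * + 0 ∣ ℕ.+ suc ‖ (λ i → x (suc i) - c * δ j i) ‖₁
    ≡⟨ cong (λ n → ℤ.∣ x zero - c * + 0 ∣ ℕ.+ suc n)
            (‖‖₁-cong (λ i → cong (λ d → x (suc i) - c * d) (sym (δ-suc j i)))) ⟩
  ℤ.∣ x zero - c * + 0 ∣ ℕ.+ suc ‖ (λ i → x (suc i) - c * δ (suc j) (suc i)) ‖₁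
    ≡⟨ ℕP.+-suc _ _ ⟩
  suc ‖ (λ i → x i - c * δ (suc j) i) ‖₁ ∎
  where
  open ≡-Reasoning

-- Sums of squares

square≡∣∣² : (z : ℤ) → z * z ≡ + (ℤ.∣ z ∣ ℕ.* ℤ.∣ z ∣)
square≡∣∣² z = trans (cong (ℤ._◃ (ℤ.∣ z ∣ ℕ.* ℤ.∣ z ∣)) (SP.s*s≡+ (ℤ.sign z))) (ℤP.+◃n≡+n _)

unit-or-large : (z : ℤ) → z ≡ + 0 ⊎ (∃ λ s → z ≡ s ◃ 1) ⊎ 2 ℕ.≤ ℤ.∣ z ∣
unit-or-large (+ zero) = inj₁ refl
unit-or-large +[1+ zero ] = inj₂ (inj₁ (S.+ , refl))
unit-or-large -[1+ zero ] = inj₂ (inj₁ (S.- , refl))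
unit-or-large +[1+ suc n ] = inj₂ (inj₂ (ℕ.s≤s (ℕ.s≤s ℕ.z≤n)))
unit-or-large -[1+ suc n ] = inj₂ (inj₂ (ℕ.s≤s (ℕ.s≤s ℕ.z≤n)))

sumSq : {k : ℕ} → (Fin k → ℤ) → ℤ
sumSq f = sum (λ v → f v * f v)

sumSq-ℕ : {k : ℕ} (f : Fin k → ℤ) → ∃ λ r → sumSq f ≡ + r
sumSq-ℕ {zero} f = 0 , refl
sumSq-ℕ {suc k} f = let r , Σ′≡r = sumSq-ℕ (f ∘ suc) in
  ℤ.∣ f zero ∣ ℕ.* ℤ.∣ f zero ∣ ℕ.+ r , cong₂ _+_ (square≡∣∣² (f zero)) Σ′≡r

sumSq-head : {k : ℕ} (f : Fin (suc k) → ℤ) {r : ℕ} → sumSq f ≡ + r →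
  (f zero ≡ + 0 × sumSq (f ∘ suc) ≡ + r)
  ⊎ (∃ λ s → f zero ≡ s ◃ 1 × ∃ λ r′ → r ≡ suc r′ × sumSq (f ∘ suc) ≡ + r′)
  ⊎ 4 ℕ.≤ r
sumSq-head f {r} Σ≡r = split (unit-or-large (f zero))
  where
  r′ : ℕ
  r′ = proj₁ (sumSq-ℕ (f ∘ suc))
  Σ′≡r′ : sumSq (f ∘ suc) ≡ + r′
  Σ′≡r′ = proj₂ (sumSq-ℕ (f ∘ suc))
  square+r′ : ℤ → ℕ
  square+r′ z = ℤ.∣ z ∣ ℕ.* ℤ.∣ z ∣ ℕ.+ r′
  r≡ : square+r′ (f zero) ≡ r
  r≡ = ℤP.+-injective (trans (sym (cong₂ _+_ (square≡∣∣² (f zero)) Σ′≡r′)) Σ≡r)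
  split : f zero ≡ + 0 ⊎ (∃ λ s → f zero ≡ s ◃ 1) ⊎ 2 ℕ.≤ ℤ.∣ f zero ∣ →
          (f zero ≡ + 0 × sumSq (f ∘ suc) ≡ + r)
          ⊎ (∃ λ s → f zero ≡ s ◃ 1 × ∃ λ r′ → r ≡ suc r′ × sumSq (f ∘ suc) ≡ + r′)
          ⊎ 4 ℕ.≤ r
  split (inj₁ f₀≡0) = inj₁ (f₀≡0 , trans Σ′≡r′ (cong +_ (trans (sym (cong square+r′ f₀≡0)) r≡)))
  split (inj₂ (inj₁ (s , f₀≡s))) = inj₂ (inj₁ (s , f₀≡s , r′ ,
    trans (sym r≡) (trans (cong square+r′ f₀≡s) (cong (λ a → a ℕ.* a ℕ.+ r′) (ℤP.abs-◃ s 1))) , Σ′≡r′))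
  split (inj₂ (inj₂ 2≤∣f₀∣)) = inj₂ (inj₂ (ℕP.≤-trans (ℕP.*-mono-≤ 2≤∣f₀∣ 2≤∣f₀∣)
    (subst (_ ℕ.≤_) r≡ (ℕP.m≤m+n _ r′))))

sumSq≡0 : {k : ℕ} (f : Fin k → ℤ) → sumSq f ≡ + 0 → ∀ v → f v ≡ + 0
sumSq≡0 {suc k} f Σ≡0 v with sumSq-head f Σ≡0
sumSq≡0 {suc k} f Σ≡0 zero | inj₁ (f₀≡0 , _) = f₀≡0
sumSq≡0 {suc k} f Σ≡0 (suc v) | inj₁ (_ , Σ′≡0) = sumSq≡0 (f ∘ suc) Σ′≡0 v
... | inj₂ (inj₁ (_ , _ , _ , () , _))
... | inj₂ (inj₂ ())

sumSq≡1 : {k : ℕ} (f : Fin k → ℤ) → sumSq f ≡ + 1 → ∃ λ a → ∃ λ s → ∀ v → f v ≡ (s ◃ 1) * δ a v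
sumSq≡1 {zero} f ()
sumSq≡1 {suc k} f Σ≡1 with sumSq-head f Σ≡1
... | inj₁ (f₀≡0 , Σ′≡1) with sumSq≡1 (f ∘ suc) Σ′≡1
...   | a , s , f′≗ = suc a , s , λ where
  zero → trans f₀≡0 (sym (ℤP.*-zeroʳ (s ◃ 1)))
  (suc v) → trans (f′≗ v) (cong ((s ◃ 1) *_) (sym (δ-suc a v)))
sumSq≡1 {suc k} f Σ≡1 | inj₂ (inj₁ (s , f₀≡s , _ , refl , Σ′≡0)) = zero , s , λ where
  zero → trans f₀≡s (sym (ℤP.*-identityʳ (s ◃ 1)))
  (suc v) → trans (sumSq≡0 (f ∘ suc) Σ′≡0 v) (sym (ℤP.*-zeroʳ (s ◃ 1)))
sumSq≡1 {suc k} f Σ≡1 | inj₂ (inj₂ (ℕ.s≤s ()))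

sumSq≡2 : {k : ℕ} (f : Fin k → ℤ) → sumSq f ≡ + 2 →
  ∃ λ a → ∃ λ b → a ≢ b × ∃ λ s → ∃ λ t → ∀ v → f v ≡ (s ◃ 1) * δ a v + (t ◃ 1) * δ b v
sumSq≡2 {zero} f ()
sumSq≡2 {suc k} f Σ≡2 with sumSq-head f Σ≡2
... | inj₁ (f₀≡0 , Σ′≡2) with sumSq≡2 (f ∘ suc) Σ′≡2
...   | a , b , a≢b , s , t , f′≗ = suc a , suc b , a≢b ∘ FinP.suc-injective , s , t , λ where
  zero → trans f₀≡0 (sym (cong₂ _+_ (ℤP.*-zeroʳ (s ◃ 1)) (ℤP.*-zeroʳ (t ◃ 1))))
  (suc v) → trans (f′≗ v) (sym (cong₂ (λ d e → (s ◃ 1) * d + (t ◃ 1) * e) (δ-suc a v) (δ-suc b v)))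
sumSq≡2 {suc k} f Σ≡2 | inj₂ (inj₁ (s , f₀≡s , _ , refl , Σ′≡1)) with sumSq≡1 (f ∘ suc) Σ′≡1
... | b , t , f′≗ = zero , suc b , (λ ()) , s , t , λ where
  zero → trans f₀≡s (sym (trans (cong₂ _+_ (ℤP.*-identityʳ (s ◃ 1)) (ℤP.*-zeroʳ (t ◃ 1))) (ℤP.+-identityʳ _)))
  (suc v) → trans (f′≗ v) (sym (trans (cong₂ _+_ (ℤP.*-zeroʳ (s ◃ 1)) (cong ((t ◃ 1) *_) (δ-suc b v)))
                                     (ℤP.+-identityˡ _)))
sumSq≡2 {suc k} f Σ≡2 | inj₂ (inj₂ (ℕ.s≤s (ℕ.s≤s ())))

-- Signs

parity : ℕ → Sign
parity zero = S.+
parity (suc k) = S.opposite (parity k)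

parity≡+⇔even : (k : ℕ) → parity k ≡ S.+ ⇔ 2 ∣ k
parity≡+⇔even zero = mk⇔ (λ _ → 2 ND.∣0) (λ _ → refl)
parity≡+⇔even (suc zero) = mk⇔ (λ ()) (λ 2∣1 → contradiction (ND.∣1⇒≡1 2∣1) (λ ()))
parity≡+⇔even (suc (suc k)) = mk⇔
  (λ p≡+ → ND.∣m∣n⇒∣m+n (ND.∣-refl {2}) (Equivalence.to (parity≡+⇔even k) (trans (sym p₂≡p) p≡+)))
  (λ 2∣2+k → trans p₂≡p (Equivalence.from (parity≡+⇔even k) (ND.∣m+n∣m⇒∣n 2∣2+k (ND.∣-refl {2}))))
  where
  p₂≡p : parity (suc (suc k)) ≡ parity k
  p₂≡p = SP.opposite-involutive (parity k)

module _ {m n : ℕ} (B : BGraph m n) where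

  private
    ⟦_⟧ : Sign → ℤ
    ⟦_⟧ = sgnℤ B

  ⟦⟧-* : (s t : Sign) → ⟦ s S.* t ⟧ ≡ ⟦ s ⟧ * ⟦ t ⟧
  ⟦⟧-* S.+ S.+ = refl
  ⟦⟧-* S.+ S.- = refl
  ⟦⟧-* S.- S.+ = refl
  ⟦⟧-* S.- S.- = refl

  ⟦⟧-square : (s : Sign) → ⟦ s ⟧ * ⟦ s ⟧ ≡ + 1
  ⟦⟧-square S.+ = refl
  ⟦⟧-square S.- = refl

  ⟦⟧-cancel-square : (s : Sign) (y : ℤ) → (⟦ s ⟧ * y) * (⟦ s ⟧ * y) ≡ y * y
  ⟦⟧-cancel-square S.+ = solve-∀
  ⟦⟧-cancel-square S.- = solve-∀

  ⟦⟧*y≡0⇒y≡0 : (s : Sign) {y : ℤ} → ⟦ s ⟧ * y ≡ + 0 → y ≡ + 0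
  ⟦⟧*y≡0⇒y≡0 S.+ {y} y≡0 = trans (sym (ℤP.*-identityˡ y)) y≡0
  ⟦⟧*y≡0⇒y≡0 S.- {y} -y≡0 = ℤP.neg-injective (trans (sym (ℤP.-1*i≡-i y)) -y≡0)

  sign-cancel : (s t : Sign) → ⟦ s ⟧ + ⟦ S.opposite (s S.* t) ⟧ * ⟦ t ⟧ ≡ + 0
  sign-cancel S.+ S.+ = refl
  sign-cancel S.+ S.- = refl
  sign-cancel S.- S.+ = refl
  sign-cancel S.- S.- = refl

  link-identity : (s t : Sign) (A C : ℤ) → ⟦ s ⟧ * (⟦ s ⟧ * A + ⟦ t ⟧ * C) ≡ A - ⟦ S.opposite (s S.* t) ⟧ * C
  link-identity S.+ S.+ = solve-∀
  link-identity S.+ S.- = solve-∀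
  link-identity S.- S.+ = solve-∀
  link-identity S.- S.- = solve-∀

  -- One step of a walk

  Inc-δ : (i : Fin n) (v : Fin m) → Inc B i v ≡ ⟦ εs B i ⟧ * δ (src B i) v + ⟦ εt B i ⟧ * δ (tgt B i) v
  Inc-δ i v = cong₂ _+_ (if-≟-δ (src B i) v _) (if-≟-δ (tgt B i) v _)

  dfun-src : {i : Fin n} → src B i ≢ tgt B i → dfun B (src B i) (fwd i) ≡ ⟦ εs B i ⟧
  dfun-src {i} src≢tgt with src B i ≟ src B i | tgt B i ≟ src B i | εs B i
  ... | no src≢src | _ | _ = contradiction refl src≢src
  ... | yes _ | yes tgt≡src | _ = contradiction (sym tgt≡src) src≢tgt
  ... | yes _ | no _ | S.+ = refl
  ... | yes _ | no _ | S.- = refl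

  dfun-tgt : {i : Fin n} → src B i ≢ tgt B i → dfun B (tgt B i) (fwd i) ≡ ⟦ εt B i ⟧
  dfun-tgt {i} src≢tgt with src B i ≟ tgt B i | tgt B i ≟ tgt B i | εt B i
  ... | yes src≡tgt | _ | _ = contradiction src≡tgt src≢tgt
  ... | no _ | no tgt≢tgt | _ = contradiction refl tgt≢tgt
  ... | no _ | yes _ | S.+ = refl
  ... | no _ | yes _ | S.- = refl

  link-∂-src : {i : Fin n} → src B i ≢ tgt B i →
               ∀ v → dfun B (src B i) (fwd i) * Inc B i v ≡ δ (src B i) v - ⟦ σ B i ⟧ * δ (tgt B i) v
  link-∂-src {i} src≢tgt v rewrite dfun-src src≢tgt | Inc-δ i v =
    link-identity (εs B i) (εt B i) (δ (src B i) v) (δ (tgt B i) v)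

  link-∂-tgt : {i : Fin n} → src B i ≢ tgt B i →
               ∀ v → dfun B (tgt B i) (fwd i) * Inc B i v ≡ δ (tgt B i) v - ⟦ σ B i ⟧ * δ (src B i) v
  link-∂-tgt {i} src≢tgt v rewrite dfun-tgt src≢tgt | Inc-δ i v = begin
    ⟦ εt B i ⟧ * (⟦ εs B i ⟧ * δ (src B i) v + ⟦ εt B i ⟧ * δ (tgt B i) v)
      ≡⟨ cong (⟦ εt B i ⟧ *_) (ℤP.+-comm (⟦ εs B i ⟧ * δ (src B i) v) (⟦ εt B i ⟧ * δ (tgt B i) v)) ⟩
    ⟦ εt B i ⟧ * (⟦ εt B i ⟧ * δ (tgt B i) v + ⟦ εs B i ⟧ * δ (src B i) v)
      ≡⟨ link-identity (εt B i) (εs B i) (δ (tgt B i) v) (δ (src B i) v) ⟩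
    δ (tgt B i) v - ⟦ S.opposite (εt B i S.* εs B i) ⟧ * δ (src B i) v
      ≡⟨ cong (λ s → δ (tgt B i) v - ⟦ S.opposite s ⟧ * δ (src B i) v) (SP.*-comm (εt B i) (εs B i)) ⟩
    δ (tgt B i) v - ⟦ σ B i ⟧ * δ (src B i) v ∎
    where open ≡-Reasoning

  link-cancel : {i : Fin n} {a a′ : Fin m} → src B i ≢ tgt B i → EndsAre B (fwd i) a a′ →
                dfun B a (fwd i) + ⟦ σ B i ⟧ * dfun B a′ (fwd i) ≡ + 0
  link-cancel {i} link (inj₁ (refl , refl)) rewrite dfun-src link | dfun-tgt link =
    sign-cancel (εs B i) (εt B i)
  link-cancel {i} link (inj₂ (refl , refl)) rewrite dfun-src link | dfun-tgt link =
    trans (cong (λ e → ⟦ εt B i ⟧ + ⟦ S.opposite e ⟧ * ⟦ εs B i ⟧) (SP.*-comm (εs B i) (εt B i)))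
          (sign-cancel (εt B i) (εs B i))

  dirLoop⇒loop : {i : Fin n} → isDirLoop B i ≡ true → src B i ≡ tgt B i
  dirLoop⇒loop {i} dirLoop with src B i ≟ tgt B i
  ... | yes src≡tgt = src≡tgt
  dirLoop⇒loop {i} () | no _

  dirLoop-at-src : {i : Fin n} → isDirLoop B i ≡ true → isDirLoopAt B (src B i) i ≡ true
  dirLoop-at-src {i} dirLoop with src B i ≟ tgt B i | src B i ≟ src B i | tgt B i ≟ src B i
  dirLoop-at-src {i} () | no _ | _ | _
  ... | yes _ | no src≢src | _ = contradiction refl src≢src
  ... | yes src≡tgt | yes _ | no tgt≢src = contradiction (sym src≡tgt) tgt≢src
  ... | yes _ | yes _ | yes _ = dirLoop

  loop-σ+⇒dirLoop : {i : Fin n} → src B i ≡ tgt B i → σ B i ≡ S.+ → isDirLoop B i ≡ true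
  loop-σ+⇒dirLoop {i} loop σ≡+ with src B i ≟ tgt B i | εs B i | εt B i
  ... | no src≢tgt | _ | _ = contradiction loop src≢tgt
  loop-σ+⇒dirLoop {i} loop () | yes _ | S.+ | S.+
  loop-σ+⇒dirLoop {i} loop () | yes _ | S.- | S.-
  ... | yes _ | S.+ | S.- = refl
  ... | yes _ | S.- | S.+ = refl

  dirLoop-fwd : {i : Fin n} → isDirLoop B i ≡ true → dfun B (src B i) (fwd i) ≡ + 1
  dirLoop-fwd dirLoop rewrite dirLoop-at-src dirLoop = refl

  dirLoop-inv : {i : Fin n} → isDirLoop B i ≡ true → dfun B (src B i) (inv i) ≡ ⟦ S.- ⟧
  dirLoop-inv dirLoop rewrite dirLoop-at-src dirLoop = refl

  dirLoop-coefficient : {i : Fin n} → isDirLoop B i ≡ true →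
                        ⟦ S.- ⟧ * (⟦ εs B i ⟧ + ⟦ εt B i ⟧) ≡ + 1 - ⟦ σ B i ⟧
  dirLoop-coefficient {i} dirLoop with src B i ≟ tgt B i | εs B i | εt B i
  dirLoop-coefficient {i} () | no _ | _ | _
  dirLoop-coefficient {i} () | yes _ | S.+ | S.+
  dirLoop-coefficient {i} () | yes _ | S.- | S.-
  ... | yes _ | S.+ | S.- = refl
  ... | yes _ | S.- | S.+ = refl

  -- On a loop i at a we have I(B)ᵀe_i = (ε + ε′) e_a, so StepValue reduces there to this scalar
  -- identity (see loop-∂).
  LoopValue : Letter B → Fin m → Set
  LoopValue l a = Σ Sign λ u → dfun B a l ≡ ⟦ u ⟧ ×
    ⟦ u ⟧ * (⟦ εs B (arrowOf B l) ⟧ + ⟦ εt B (arrowOf B l) ⟧) ≡ + 1 - ⟦ σL B l ⟧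

  fwd-loop-value : {i : Fin n} {a : Fin m} → src B i ≡ a → tgt B i ≡ a → LoopValue (fwd i) a
  fwd-loop-value {i} refl tgt≡src with src B i ≟ src B i | tgt B i ≟ src B i | εs B i | εt B i
  ... | no src≢src | _ | _ | _ = contradiction refl src≢src
  ... | yes _ | no tgt≢src | _ | _ = contradiction tgt≡src tgt≢src
  ... | yes _ | yes _ | S.+ | S.+ = S.+ , refl , refl
  ... | yes _ | yes _ | S.+ | S.- = S.+ , refl , refl
  ... | yes _ | yes _ | S.- | S.+ = S.+ , refl , refl
  ... | yes _ | yes _ | S.- | S.- = S.- , refl , refl

  inv-loop-value : {i : Fin n} {a : Fin m} → isDirLoop B i ≡ true → src B i ≡ a → LoopValue (inv i) a
  inv-loop-value dirLoop refl = S.- , dirLoop-inv dirLoop , dirLoop-coefficient dirLoop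

  loop-∂ : {i : Fin n} {a : Fin m} (c : ℤ) → src B i ≡ a → tgt B i ≡ a →
           c * (⟦ εs B i ⟧ + ⟦ εt B i ⟧) ≡ + 1 - ⟦ σ B i ⟧ →
           ∀ v → c * Inc B i v ≡ δ a v - ⟦ σ B i ⟧ * δ a v
  loop-∂ {i} {a} c refl tgt≡a coefficient v = begin
    c * Inc B i v
      ≡⟨ cong (c *_) (Inc-δ i v) ⟩
    c * (⟦ εs B i ⟧ * δ a v + ⟦ εt B i ⟧ * δ (tgt B i) v)
      ≡⟨ cong (λ w → c * (⟦ εs B i ⟧ * δ a v + ⟦ εt B i ⟧ * δ w v)) tgt≡a ⟩
    c * (⟦ εs B i ⟧ * δ a v + ⟦ εt B i ⟧ * δ a v)
      ≡⟨ factor c (⟦ εs B i ⟧) (⟦ εt B i ⟧) (δ a v) ⟩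
    c * (⟦ εs B i ⟧ + ⟦ εt B i ⟧) * δ a v
      ≡⟨ cong (_* δ a v) coefficient ⟩
    (+ 1 - ⟦ σ B i ⟧) * δ a v
      ≡⟨ expand (⟦ σ B i ⟧) (δ a v) ⟩
    δ a v - ⟦ σ B i ⟧ * δ a v ∎
    where
    open ≡-Reasoning
    factor : ∀ c e f d → c * (e * d + f * d) ≡ c * (e + f) * d
    factor = solve-∀
    expand : ∀ s d → (+ 1 - s) * d ≡ d - s * d
    expand = solve-∀

  loop-ends : (l : Letter B) {a a′ : Fin m} → src B (arrowOf B l) ≡ tgt B (arrowOf B l) → EndsAre B l a a′ →
              src B (arrowOf B l) ≡ a × tgt B (arrowOf B l) ≡ a × a′ ≡ a
  loop-ends l loop (inj₁ (src≡a , tgt≡a′)) =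
    src≡a , trans (sym loop) src≡a , trans (sym tgt≡a′) (trans (sym loop) src≡a)
  loop-ends l loop (inj₂ (src≡a′ , tgt≡a)) =
    trans loop tgt≡a , tgt≡a , trans (sym src≡a′) (trans loop tgt≡a)

  StepValue : Letter B → Fin m → Fin m → Set
  StepValue l a a′ = Σ Sign λ u → dfun B a l ≡ ⟦ u ⟧ ×
    (∀ v → dfun B a l * Inc B (arrowOf B l) v ≡ δ a v - ⟦ σL B l ⟧ * δ a′ v)

  loop-step-value : (l : Letter B) {a a′ : Fin m} → src B (arrowOf B l) ≡ tgt B (arrowOf B l) →
    EndsAre B l a a′ → LoopValue l a → StepValue l a a′
  loop-step-value l {a} loop ends (u , d≡u , coefficient) with loop-ends l loop ends
  ... | src≡a , tgt≡a , refl = u , d≡u ,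
    loop-∂ (dfun B a l) src≡a tgt≡a (trans (cong (_* _) d≡u) coefficient)

  step-value : (l : Letter B) {a a′ : Fin m} → Step B l a a′ → StepValue l a a′
  step-value (fwd i) ends with src B i ≟ tgt B i
  ... | yes loop = let src≡a , tgt≡a , _ = loop-ends (fwd i) loop ends in
    loop-step-value (fwd i) loop ends (fwd-loop-value src≡a tgt≡a)
  step-value (fwd i) (inj₁ (refl , refl)) | no link = εs B i , dfun-src link , link-∂-src link
  step-value (fwd i) (inj₂ (refl , refl)) | no link = εt B i , dfun-tgt link , link-∂-tgt link
  step-value (inv i) (dirLoop , ends) = loop-step-value (inv i) loop ends
    (inv-loop-value dirLoop (proj₁ (loop-ends (inv i) loop ends)))
    where
    loop : src B i ≡ tgt B i
    loop = dirLoop⇒loop dirLoop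

  -- Walks and their incidence vectors

  sgnW : {a b : Fin m} → Walk B a b → Sign
  sgnW ([] _) = S.+
  sgnW ((l , _) ∷ ω) = σL B l S.* sgnW ω

  infixr 5 _++ʷ_
  _++ʷ_ : {a b c : Fin m} → Walk B a b → Walk B b c → Walk B a c
  [] _ ++ʷ ω′ = ω′
  (l ∷ ω) ++ʷ ω′ = l ∷ (ω ++ʷ ω′)

  sgnW-++ : {a b c : Fin m} (ω : Walk B a b) (ω′ : Walk B b c) → sgnW (ω ++ʷ ω′) ≡ sgnW ω S.* sgnW ω′
  sgnW-++ ([] _) ω′ = refl
  sgnW-++ ((l , _) ∷ ω) ω′ =
    trans (cong (σL B l S.*_) (sgnW-++ ω ω′)) (sym (SP.*-assoc (σL B l) (sgnW ω) (sgnW ω′)))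

  incFrom-++ : {a b c : Fin m} (s : Sign) (ω : Walk B a b) (ω′ : Walk B b c) →
               ∀ j → incFrom B s (ω ++ʷ ω′) j ≡ incFrom B s ω j + incFrom B (s S.* sgnW ω) ω′ j
  incFrom-++ s ([] _) ω′ j =
    trans (cong (λ s′ → incFrom B s′ ω′ j) (sym (SP.*-identityʳ s))) (sym (ℤP.+-identityˡ _))
  incFrom-++ {a} s ((l , _) ∷ ω) ω′ j = begin
    first + incFrom B (s S.* σL B l) (ω ++ʷ ω′) j
      ≡⟨ cong (_+_ first) (incFrom-++ (s S.* σL B l) ω ω′ j) ⟩
    first + (incFrom B (s S.* σL B l) ω j + incFrom B ((s S.* σL B l) S.* sgnW ω) ω′ j)
      ≡⟨ sym (ℤP.+-assoc first _ _) ⟩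
    first + incFrom B (s S.* σL B l) ω j + incFrom B ((s S.* σL B l) S.* sgnW ω) ω′ j
      ≡⟨ cong (λ s′ → first + incFrom B (s S.* σL B l) ω j + incFrom B s′ ω′ j)
              (SP.*-assoc s (σL B l) (sgnW ω)) ⟩
    first + incFrom B (s S.* σL B l) ω j + incFrom B (s S.* (σL B l S.* sgnW ω)) ω′ j ∎
    where
    open ≡-Reasoning
    first : ℤ
    first = (⟦ s ⟧ * dfun B a l) * unit B (arrowOf B l) j

  incFrom-* : {a b : Fin m} (s t : Sign) (ω : Walk B a b) →
              ∀ j → incFrom B (s S.* t) ω j ≡ ⟦ s ⟧ * incFrom B t ω j
  incFrom-* s t ([] _) j = sym (ℤP.*-zeroʳ ⟦ s ⟧)
  incFrom-* {a} s t ((l , _) ∷ ω) j = begin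
    ⟦ s S.* t ⟧ * dfun B a l * unit B (arrowOf B l) j + incFrom B ((s S.* t) S.* σL B l) ω j
      ≡⟨ cong₂ (λ c s′ → c * dfun B a l * unit B (arrowOf B l) j + incFrom B s′ ω j)
               (⟦⟧-* s t) (SP.*-assoc s t (σL B l)) ⟩
    ⟦ s ⟧ * ⟦ t ⟧ * dfun B a l * unit B (arrowOf B l) j + incFrom B (s S.* (t S.* σL B l)) ω j
      ≡⟨ cong (_+_ (⟦ s ⟧ * ⟦ t ⟧ * dfun B a l * unit B (arrowOf B l) j)) (incFrom-* s (t S.* σL B l) ω j) ⟩
    ⟦ s ⟧ * ⟦ t ⟧ * dfun B a l * unit B (arrowOf B l) j + ⟦ s ⟧ * incFrom B (t S.* σL B l) ω j
      ≡⟨ pull (⟦ s ⟧) (⟦ t ⟧) (dfun B a l) (unit B (arrowOf B l) j) (incFrom B (t S.* σL B l) ω j) ⟩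
    ⟦ s ⟧ * (⟦ t ⟧ * dfun B a l * unit B (arrowOf B l) j + incFrom B (t S.* σL B l) ω j) ∎
    where
    open ≡-Reasoning
    pull : ∀ x y z w r → x * y * z * w + x * r ≡ x * (y * z * w + r)
    pull = solve-∀

  incFrom-−≡-inc : {a b : Fin m} (ω : Walk B a b) → ∀ j → incFrom B S.- ω j ≡ - inc B ω j
  incFrom-−≡-inc ω j = trans (incFrom-* S.- S.+ ω j) (ℤP.-1*i≡-i (inc B ω j))

  σ-parity : (i : Fin n) (N : ℕ) → σ B i S.* parity N ≡ parity ((if isBidirected B i then 1 else 0) ℕ.+ N)
  σ-parity i N with εs B i | εt B i
  ... | S.+ | S.+ = refl
  ... | S.+ | S.- = refl
  ... | S.- | S.+ = refl
  ... | S.- | S.- = refl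

  sgnW≡parity : {a b : Fin m} (ω : Walk B a b) → sgnW ω ≡ parity (nBidir B ω)
  sgnW≡parity ([] _) = refl
  sgnW≡parity ((fwd i , _) ∷ ω) = trans (cong (σ B i S.*_) (sgnW≡parity ω)) (σ-parity i (nBidir B ω))
  sgnW≡parity ((inv i , _) ∷ ω) = trans (cong (σ B i S.*_) (sgnW≡parity ω)) (σ-parity i (nBidir B ω))

  even⇔sgnW≡+ : {a b : Fin m} (ω : Walk B a b) → EvenBidir B ω ⇔ sgnW ω ≡ S.+
  even⇔sgnW≡+ ω = mk⇔ (λ even → trans (sgnW≡parity ω) (Equivalence.from (parity≡+⇔even _) even))
                       (λ sgnW≡+ → Equivalence.to (parity≡+⇔even _) (trans (sym (sgnW≡parity ω)) sgnW≡+))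

  -- The boundary I(B)ᵀx and the value of q

  ∂ : Vecℤ B → Fin m → ℤ
  ∂ x v = sum (λ i → Inc B i v * x i)

  Σℤ≡sum : {k : ℕ} (f : Fin k → ℤ) → Σℤ B f ≡ sum f
  Σℤ≡sum {zero} f = refl
  Σℤ≡sum {suc k} f = cong (_+_ (f zero)) (Σℤ≡sum (f ∘ suc))

  twoQ≡sumSq∂ : (x : Vecℤ B) → twoQ B x ≡ sumSq (∂ x)
  twoQ≡sumSq∂ x = trans (Σℤ≡sum (λ v → ∂ᶻ v * ∂ᶻ v))
    (sum-cong-≗ (λ v → cong₂ _*_ (Σℤ≡sum (λ i → Inc B i v * x i)) (Σℤ≡sum (λ i → Inc B i v * x i))))
    where
    ∂ᶻ : Fin m → ℤ
    ∂ᶻ v = Σℤ B (λ i → Inc B i v * x i)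

  ∂-cong : {x y : Vecℤ B} → (∀ j → x j ≡ y j) → ∀ v → ∂ x v ≡ ∂ y v
  ∂-cong x≗y v = sum-cong-≗ (λ i → cong (Inc B i v *_) (x≗y i))

  ∂-+ : (x y : Vecℤ B) → ∀ v → ∂ (λ j → x j + y j) v ≡ ∂ x v + ∂ y v
  ∂-+ x y v = trans (sum-cong-≗ (λ i → ℤP.*-distribˡ-+ (Inc B i v) (x i) (y i)))
                    (∑-distrib-+ (λ i → Inc B i v * x i) (λ i → Inc B i v * y i))

  ∂-unit : (c : ℤ) (i : Fin n) → ∀ v → ∂ (λ j → c * unit B i j) v ≡ c * Inc B i v
  ∂-unit c i v =
    trans (sum-cong-≗ (λ j → reorder (Inc B j v) c (δ i j))) (sum-δ-select (λ j → c * Inc B j v) i)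
    where
    reorder : ∀ x y z → x * (y * z) ≡ y * x * z
    reorder = solve-∀

  ∂-zero : ∀ v → ∂ (zeroV B) v ≡ + 0
  ∂-zero v = trans (sum-cong-≗ (λ i → ℤP.*-zeroʳ (Inc B i v))) (sum-replicate-zero n)

  HasBoundary : Vecℤ B → Sign → Fin m → Fin m → Sign → Set
  HasBoundary x s a b t = ∀ v → ∂ x v ≡ ⟦ s ⟧ * (δ a v - ⟦ t ⟧ * δ b v)

  closed+-vanishes : (s : Sign) (a v : Fin m) → ⟦ s ⟧ * (δ a v - ⟦ S.+ ⟧ * δ a v) ≡ + 0
  closed+-vanishes s a v = vanish (⟦ s ⟧) (δ a v)
    where
    vanish : ∀ S D → S * (D - + 1 * D) ≡ + 0
    vanish = solve-∀

  ∂-incFrom : {a b : Fin m} (s : Sign) (ω : Walk B a b) → HasBoundary (incFrom B s ω) s a b (sgnW ω)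
  ∂-incFrom {a} s ([] _) v = trans (∂-zero v) (sym (closed+-vanishes s a v))
  ∂-incFrom {a} {b} s (_∷_ {w = a′} (l , st) ω) v with step-value l st
  ... | _ , _ , d*Inc≡ = begin
    ∂ (incFrom B s ((l , st) ∷ ω)) v
      ≡⟨ ∂-+ _ _ v ⟩
    ∂ (λ j → ⟦ s ⟧ * d * unit B (arrowOf B l) j) v + ∂ (incFrom B (s S.* σL B l) ω) v
      ≡⟨ cong₂ _+_ (∂-unit (⟦ s ⟧ * d) (arrowOf B l) v) (∂-incFrom (s S.* σL B l) ω v) ⟩
    ⟦ s ⟧ * d * Inc B (arrowOf B l) v + ⟦ s S.* σL B l ⟧ * (δ a′ v - ⟦ sgnW ω ⟧ * δ b v)
      ≡⟨ cong₂ (λ e f → e + f * (δ a′ v - ⟦ sgnW ω ⟧ * δ b v))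
               (trans (ℤP.*-assoc (⟦ s ⟧) d _) (cong (⟦ s ⟧ *_) (d*Inc≡ v))) (⟦⟧-* s (σL B l)) ⟩
    ⟦ s ⟧ * (δ a v - ⟦ σL B l ⟧ * δ a′ v) + ⟦ s ⟧ * ⟦ σL B l ⟧ * (δ a′ v - ⟦ sgnW ω ⟧ * δ b v)
      ≡⟨ telescope (⟦ s ⟧) (⟦ σL B l ⟧) (⟦ sgnW ω ⟧) (δ a v) (δ a′ v) (δ b v) ⟩
    ⟦ s ⟧ * (δ a v - ⟦ σL B l ⟧ * ⟦ sgnW ω ⟧ * δ b v)
      ≡⟨ cong (λ e → ⟦ s ⟧ * (δ a v - e * δ b v)) (sym (⟦⟧-* (σL B l) (sgnW ω))) ⟩
    ⟦ s ⟧ * (δ a v - ⟦ σL B l S.* sgnW ω ⟧ * δ b v) ∎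
    where
    open ≡-Reasoning
    d : ℤ
    d = dfun B a l
    telescope : ∀ S σ τ A A′ C → S * (A - σ * A′) + S * σ * (A′ - τ * C) ≡ S * (A - σ * τ * C)
    telescope = solve-∀

  twoQ-open : {x : Vecℤ B} {s t : Sign} {a b : Fin m} → a ≢ b → HasBoundary x s a b t → twoQ B x ≡ + 2
  twoQ-open {x} {s} {t} {a} {b} a≢b ∂x = begin
    twoQ B x                  ≡⟨ twoQ≡sumSq∂ x ⟩
    sumSq (∂ x)               ≡⟨ sum-cong-≗ (λ v → trans (cong (λ y → y * y) (∂x v))
                                   (trans (⟦⟧-cancel-square s _) (open-square t v))) ⟩
    sum (λ v → δ a v + δ b v) ≡⟨ ∑-distrib-+ (δ a) (δ b) ⟩
    sum (δ a) + sum (δ b)     ≡⟨ cong₂ _+_ (sum-δ a) (sum-δ b) ⟩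
    + 2                       ∎
    where
    open ≡-Reasoning
    open-square : ∀ t v → (δ a v - ⟦ t ⟧ * δ b v) * (δ a v - ⟦ t ⟧ * δ b v) ≡ δ a v + δ b v
    open-square t v with a ≟ v | b ≟ v
    open-square t v | yes refl | yes refl = contradiction refl a≢b
    open-square S.+ v | yes _ | no _ = refl
    open-square S.- v | yes _ | no _ = refl
    open-square S.+ v | no _ | yes _ = refl
    open-square S.- v | no _ | yes _ = refl
    open-square S.+ v | no _ | no _ = refl
    open-square S.- v | no _ | no _ = refl

  twoQ-closed+ : {x : Vecℤ B} {s : Sign} {a : Fin m} → HasBoundary x s a a S.+ → twoQ B x ≡ + 0
  twoQ-closed+ {x} {s} {a} ∂x = begin
    twoQ B x            ≡⟨ twoQ≡sumSq∂ x ⟩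
    sumSq (∂ x)         ≡⟨ sum-cong-≗ (λ v → cong (λ y → y * y) (trans (∂x v) (closed+-vanishes s a v))) ⟩
    sum {m} (λ _ → + 0) ≡⟨ sum-replicate-zero m ⟩
    + 0                 ∎
    where open ≡-Reasoning

  twoQ-closed- : {x : Vecℤ B} {s : Sign} {a : Fin m} → HasBoundary x s a a S.- → twoQ B x ≡ + 4
  twoQ-closed- {x} {s} {a} ∂x = begin
    twoQ B x                ≡⟨ twoQ≡sumSq∂ x ⟩
    sumSq (∂ x)             ≡⟨ sum-cong-≗ (λ v → trans (cong (λ y → y * y) (∂x v))
                                 (trans (⟦⟧-cancel-square s _) (closed-square v))) ⟩
    sum (λ v → + 4 * δ a v) ≡⟨ sym (*-distribˡ-sum (+ 4) (δ a)) ⟩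
    + 4 * sum (δ a)         ≡⟨ cong (+ 4 *_) (sum-δ a) ⟩
    + 4                     ∎
    where
    open ≡-Reasoning
    closed-square : ∀ v → (δ a v - ⟦ S.- ⟧ * δ a v) * (δ a v - ⟦ S.- ⟧ * δ a v) ≡ + 4 * δ a v
    closed-square v with a ≟ v
    ... | yes _ = refl
    ... | no _ = refl

  Rq-unique : (d d′ : ℕ) {x : Vecℤ B} → Rq B d x → Rq B d′ x → d ≡ d′
  Rq-unique d d′ q q′ = ℕP.*-cancelˡ-≡ d d′ 2 (ℤP.+-injective (trans (sym q) q′))

  PMInc⇒HasBoundary : {a b : Fin m} {x : Vecℤ B} (ω : Walk B a b) → PMInc B ω x →
                      Σ Sign λ s → HasBoundary x s a b (sgnW ω)
  PMInc⇒HasBoundary ω (inj₁ x≗inc) = S.+ , λ v → trans (∂-cong x≗inc v) (∂-incFrom S.+ ω v)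
  PMInc⇒HasBoundary ω (inj₂ x≗-inc) =
    S.- , λ v → trans (∂-cong (λ j → trans (x≗-inc j) (sym (incFrom-−≡-inc ω j))) v) (∂-incFrom S.- ω v)

  walk-classification : {a b : Fin m} {x : Vecℤ B} (ω : Walk B a b) → PMInc B ω x →
    (a ≢ b × Rq B 1 x) ⊎ (a ≡ b × EvenBidir B ω × Rq B 0 x) ⊎ (a ≡ b × ¬ EvenBidir B ω × Rq B 2 x)
  walk-classification {a} {b} ω pm with PMInc⇒HasBoundary ω pm | a ≟ b
  ... | s , ∂x | no a≢b = inj₁ (a≢b , twoQ-open {s = s} {t = sgnW ω} a≢b ∂x)
  ... | s , ∂x | yes refl with sgnW ω in sgnW≡
  ...   | S.+ = inj₂ (inj₁ (refl , Equivalence.from (even⇔sgnW≡+ ω) sgnW≡ , twoQ-closed+ {s = s} {a} ∂x))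
  ...   | S.- = inj₂ (inj₂ (refl , odd , twoQ-closed- {s = s} {a} ∂x))
    where
    odd : ¬ EvenBidir B ω
    odd even = case trans (sym sgnW≡) (Equivalence.to (even⇔sgnW≡+ ω) even) of λ ()

  -- Realising a vector by a walk

  δ-⟦⟧δ-nonneg : (t : Sign) (a b : Fin m) → + 0 ℤ.≤ δ a a - ⟦ t ⟧ * δ b a
  δ-⟦⟧δ-nonneg t a b rewrite δ-refl a with b ≟ a | t
  ... | yes _ | S.+ = +≤+ ℕ.z≤n
  ... | yes _ | S.- = +≤+ ℕ.z≤n
  ... | no _ | S.+ = +≤+ ℕ.z≤n
  ... | no _ | S.- = +≤+ ℕ.z≤n

  δ-⟦⟧δ≡0⇒closed : (t : Sign) (a b : Fin m) → δ a a - ⟦ t ⟧ * δ b a ≡ + 0 → b ≡ a × t ≡ S.+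
  δ-⟦⟧δ≡0⇒closed t a b rewrite δ-refl a with b ≟ a | t
  ... | yes b≡a | S.+ = λ _ → b≡a , refl
  ... | yes _ | S.- = λ ()
  ... | no _ | S.+ = λ ()
  ... | no _ | S.- = λ ()

  Realisation : Vecℤ B → Sign → Fin m → Fin m → Sign → Set
  Realisation x s a b t = Σ (Walk B a b) λ ω → sgnW ω ≡ t × (∀ j → incFrom B s ω j ≡ x j)

  -- Stepping along l removes ⟦ s ⟧ d(a,l) e_l from x, which lowers ‖ x ‖₁ by one.
  Descent : Vecℤ B → Sign → Fin m → Set
  Descent x s a =
    Σ (Letter B) λ l → Σ (Fin m) λ a′ → Step B l a a′ × + 0 ℤ.< ⟦ s ⟧ * dfun B a l * x (arrowOf B l)

  ∂-descend : {x : Vecℤ B} {s t : Sign} {a a′ b : Fin m} (l : Letter B) → Step B l a a′ →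
    HasBoundary x s a b t →
    HasBoundary (λ j → x j - ⟦ s ⟧ * dfun B a l * δ (arrowOf B l) j) (s S.* σL B l) a′ b (t S.* σL B l)
  ∂-descend {x} {s} {t} {a} {a′} {b} l st ∂x v with step-value l st
  ... | _ , _ , d*Inc≡ = begin
    ∂ (λ j → x j - c * δ (arrowOf B l) j) v
      ≡⟨ ∂-cong (λ j → cong (_+_ (x j)) (ℤP.neg-distribˡ-* c (δ (arrowOf B l) j))) v ⟩
    ∂ (λ j → x j + (- c) * unit B (arrowOf B l) j) v
      ≡⟨ ∂-+ x _ v ⟩
    ∂ x v + ∂ (λ j → (- c) * unit B (arrowOf B l) j) v
      ≡⟨ cong₂ _+_ (∂x v) (∂-unit (- c) (arrowOf B l) v) ⟩
    ⟦ s ⟧ * (δ a v - ⟦ t ⟧ * δ b v) + (- c) * Inc B (arrowOf B l) v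
      ≡⟨ cong (_+_ (⟦ s ⟧ * (δ a v - ⟦ t ⟧ * δ b v))) (regroup (⟦ s ⟧) (dfun B a l) (Inc B (arrowOf B l) v)) ⟩
    ⟦ s ⟧ * (δ a v - ⟦ t ⟧ * δ b v) - ⟦ s ⟧ * (dfun B a l * Inc B (arrowOf B l) v)
      ≡⟨ cong (λ y → ⟦ s ⟧ * (δ a v - ⟦ t ⟧ * δ b v) - ⟦ s ⟧ * y) (d*Inc≡ v) ⟩
    ⟦ s ⟧ * (δ a v - ⟦ t ⟧ * δ b v) - ⟦ s ⟧ * (δ a v - ⟦ σL B l ⟧ * δ a′ v)
      ≡⟨ shift (σL B l) (⟦ s ⟧) (⟦ t ⟧) (δ a v) (δ a′ v) (δ b v) ⟩
    ⟦ s ⟧ * ⟦ σL B l ⟧ * (δ a′ v - ⟦ t ⟧ * ⟦ σL B l ⟧ * δ b v)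
      ≡⟨ sym (cong₂ (λ e f → e * (δ a′ v - f * δ b v)) (⟦⟧-* s (σL B l)) (⟦⟧-* t (σL B l))) ⟩
    ⟦ s S.* σL B l ⟧ * (δ a′ v - ⟦ t S.* σL B l ⟧ * δ b v) ∎
    where
    open ≡-Reasoning
    c : ℤ
    c = ⟦ s ⟧ * dfun B a l
    regroup : ∀ S d I → (- (S * d)) * I ≡ - (S * (d * I))
    regroup = solve-∀
    shift : ∀ σ′ S T A A′ C → S * (A - T * C) - S * (A - ⟦ σ′ ⟧ * A′) ≡ S * ⟦ σ′ ⟧ * (A′ - T * ⟦ σ′ ⟧ * C)
    shift S.+ = solve-∀
    shift S.- = solve-∀

  descend : {k : ℕ} → (∀ x′ → ‖ x′ ‖₁ ≡ k → ∀ {s a b t} → HasBoundary x′ s a b t → Realisation x′ s a b t) →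
            ∀ {x s a b t} → ‖ x ‖₁ ≡ suc k → HasBoundary x s a b t → Descent x s a → Realisation x s a b t
  descend IH {x} {s} {a} {b} {t} ‖x‖≡1+k ∂x (l , a′ , st , 0<cxj) =
    (l , st) ∷ ω′ , sgnW≡t , inc≡x
    where
    j : Fin n
    j = arrowOf B l
    c : ℤ
    c = ⟦ s ⟧ * dfun B a l
    c²≡1 : c * c ≡ + 1
    c²≡1 with step-value l st
    ... | u , d≡u , _ = begin
      c * c                             ≡⟨ cong (λ d → (⟦ s ⟧ * d) * (⟦ s ⟧ * d)) d≡u ⟩
      (⟦ s ⟧ * ⟦ u ⟧) * (⟦ s ⟧ * ⟦ u ⟧) ≡⟨ cong (λ y → y * y) (sym (⟦⟧-* s u)) ⟩
      ⟦ s S.* u ⟧ * ⟦ s S.* u ⟧         ≡⟨ ⟦⟧-square (s S.* u) ⟩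
      + 1                               ∎
      where open ≡-Reasoning
    x′ : Vecℤ B
    x′ i = x i - c * δ j i
    realisation′ : Realisation x′ (s S.* σL B l) a′ b (t S.* σL B l)
    realisation′ = IH x′ (ℕP.suc-injective (trans (sym (‖‖₁-descent x j c c²≡1 0<cxj)) ‖x‖≡1+k))
                         (∂-descend {x} {s} {t} l st ∂x)
    ω′ : Walk B a′ b
    ω′ = proj₁ realisation′
    sgnW≡t : σL B l S.* sgnW ω′ ≡ t
    sgnW≡t = trans (cong (σL B l S.*_) (proj₁ (proj₂ realisation′))) (unwind (σL B l) t)
      where
      unwind : ∀ σ′ t → σ′ S.* (t S.* σ′) ≡ t
      unwind S.+ S.+ = refl
      unwind S.+ S.- = refl
      unwind S.- S.+ = refl
      unwind S.- S.- = refl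
    inc≡x : ∀ i → c * unit B j i + incFrom B (s S.* σL B l) ω′ i ≡ x i
    inc≡x i = trans (cong (_+_ (c * δ j i)) (proj₂ (proj₂ realisation′) i)) (cancel (c * δ j i) (x i))
      where
      cancel : ∀ y z → y + (z - y) ≡ z
      cancel = solve-∀

  incident : (i : Fin n) {a : Fin m} → Inc B i a ≢ + 0 → Σ (Fin m) λ a′ → EndsAre B (fwd i) a a′
  incident i {a} Inc≢0 with src B i ≟ a | tgt B i ≟ a
  ... | yes src≡a | _ = tgt B i , inj₁ (src≡a , refl)
  ... | no _ | yes tgt≡a = src B i , inj₂ (refl , tgt≡a)
  ... | no _ | no _ = contradiction refl Inc≢0

  positive-term⇒Inc≢0 : {x : Vecℤ B} {s : Sign} {a : Fin m} (i : Fin n) →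
                        + 0 ℤ.< ⟦ s ⟧ * (Inc B i a * x i) → Inc B i a ≢ + 0
  positive-term⇒Inc≢0 {x} {s} i 0<term Inc≡0 =
    ℤP.<-irrefl (sym (trans (cong (λ I → ⟦ s ⟧ * (I * x i)) Inc≡0) (ℤP.*-zeroʳ ⟦ s ⟧))) 0<term

  -- d(a,i) · I(B)ᵢₐ = δ a a − σ(i) δ a′ a is 1, 2 or 0 (link, bidirected loop, directed loop), so a
  -- positive term of ⟦ s ⟧ · (I(B)ᵀx)ₐ gives a descent along i.
  descent-from-term : {x : Vecℤ B} {s : Sign} {a : Fin m} (i : Fin n) →
                      + 0 ℤ.< ⟦ s ⟧ * (Inc B i a * x i) → Descent x s a
  descent-from-term {x} {s} {a} i 0<term with incident i (positive-term⇒Inc≢0 {x} {s} i 0<term)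
  ... | a′ , ends with step-value (fwd i) ends
  ...   | u , d≡u , d*Inc≡ = fwd i , a′ , ends ,
    0≤i⇒0<i*j⇒0<j (δ-⟦⟧δ-nonneg (σ B i) a a′) (subst (+ 0 ℤ.<_) factorise 0<term)
    where
    open ≡-Reasoning
    regroup : ∀ u S I X → S * (I * X) ≡ (⟦ u ⟧ * I) * (S * ⟦ u ⟧ * X)
    regroup S.+ = solve-∀
    regroup S.- = solve-∀
    factorise : ⟦ s ⟧ * (Inc B i a * x i) ≡ (δ a a - ⟦ σ B i ⟧ * δ a′ a) * (⟦ s ⟧ * dfun B a (fwd i) * x i)
    factorise = begin
      ⟦ s ⟧ * (Inc B i a * x i)
        ≡⟨ regroup u (⟦ s ⟧) (Inc B i a) (x i) ⟩
      (⟦ u ⟧ * Inc B i a) * (⟦ s ⟧ * ⟦ u ⟧ * x i)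
        ≡⟨ cong (λ d → (d * Inc B i a) * (⟦ s ⟧ * d * x i)) (sym d≡u) ⟩
      (dfun B a (fwd i) * Inc B i a) * (⟦ s ⟧ * dfun B a (fwd i) * x i)
        ≡⟨ cong (_* (⟦ s ⟧ * dfun B a (fwd i) * x i)) (d*Inc≡ a) ⟩
      (δ a a - ⟦ σ B i ⟧ * δ a′ a) * (⟦ s ⟧ * dfun B a (fwd i) * x i) ∎

  Inc-src≢0 : {i : Fin n} → isDirLoop B i ≡ false → Inc B i (src B i) ≢ + 0
  Inc-src≢0 {i} notDirLoop Inc≡0 with step-value (fwd i) (inj₁ (refl , refl))
  ... | _ , _ , d*Inc≡ with δ-⟦⟧δ≡0⇒closed (σ B i) (src B i) (tgt B i)
         (trans (sym (d*Inc≡ (src B i))) (trans (cong (dfun B (src B i) (fwd i) *_) Inc≡0)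
                                                (ℤP.*-zeroʳ (dfun B (src B i) (fwd i)))))
  ...   | tgt≡src , σ≡+ = case trans (sym (loop-σ+⇒dirLoop (sym tgt≡src) σ≡+)) notDirLoop of λ ()

  dirLoop-descent : {x : Vecℤ B} {i : Fin n} → isDirLoop B i ≡ true → x i ≢ + 0 →
                    ∀ s → Descent x s (src B i)
  dirLoop-descent {x} {i} dirLoop xi≢0 s with ℤP.<-cmp (+ 0) (⟦ s ⟧ * x i)
  ... | tri< 0<sx _ _ = fwd i , src B i , inj₁ (refl , sym (dirLoop⇒loop dirLoop)) ,
    subst (λ d → + 0 ℤ.< ⟦ s ⟧ * d * x i) (sym (dirLoop-fwd dirLoop))
          (subst (+ 0 ℤ.<_) (cong (_* x i) (sym (ℤP.*-identityʳ ⟦ s ⟧))) 0<sx)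
  ... | tri≈ _ 0≡sx _ = contradiction (⟦⟧*y≡0⇒y≡0 s (sym 0≡sx)) xi≢0
  ... | tri> _ _ sx<0 = inv i , src B i , (dirLoop , inj₁ (refl , sym (dirLoop⇒loop dirLoop))) ,
    subst (λ d → + 0 ℤ.< ⟦ s ⟧ * d * x i) (sym (dirLoop-inv dirLoop))
          (subst (+ 0 ℤ.<_) (flip (⟦ s ⟧) (x i)) (ℤP.neg-mono-< sx<0))
    where
    flip : ∀ S X → - (S * X) ≡ S * - + 1 * X
    flip = solve-∀

  descent-at-support : {x : Vecℤ B} (i : Fin n) → (∀ v → ∂ x v ≡ + 0) → x i ≢ + 0 →
                       ∀ s → Descent x s (src B i)
  descent-at-support {x} i ∂x≡0 xi≢0 s with isDirLoop B i in dirLoop?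
  ... | true = dirLoop-descent dirLoop? xi≢0 s
  ... | false = descent-from-term {x} {s} (proj₁ positive) (proj₂ positive)
    where
    c : Fin m
    c = src B i
    term≢0 : ⟦ s ⟧ * (Inc B i c * x i) ≢ + 0
    term≢0 = [ Inc-src≢0 dirLoop? , xi≢0 ]′ ∘ ℤP.i*j≡0⇒i≡0∨j≡0 (Inc B i c) ∘ ⟦⟧*y≡0⇒y≡0 s
    Σ≡0 : sum (λ j → ⟦ s ⟧ * (Inc B j c * x j)) ≡ + 0
    Σ≡0 = trans (sym (*-distribˡ-sum ⟦ s ⟧ (λ j → Inc B j c * x j)))
                (trans (cong (⟦ s ⟧ *_) (∂x≡0 c)) (ℤP.*-zeroʳ ⟦ s ⟧))
    positive : ∃ λ j → + 0 ℤ.< ⟦ s ⟧ * (Inc B j c * x j)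
    positive = positive-term-of-zero-sum (λ j → ⟦ s ⟧ * (Inc B j c * x j)) i Σ≡0 term≢0

  open-descent : {x : Vecℤ B} {s t : Sign} {a b : Fin m} → ¬ (b ≡ a × t ≡ S.+) →
                 HasBoundary x s a b t → Descent x s a
  open-descent {x} {s} {t} {a} {b} not-closed ∂x =
    descent-from-term {x} {s} (proj₁ positive) (proj₂ positive)
    where
    μ : ℤ
    μ = δ a a - ⟦ t ⟧ * δ b a
    Σ≡μ : sum (λ i → ⟦ s ⟧ * (Inc B i a * x i)) ≡ μ
    Σ≡μ = begin
      sum (λ i → ⟦ s ⟧ * (Inc B i a * x i)) ≡⟨ sym (*-distribˡ-sum ⟦ s ⟧ (λ i → Inc B i a * x i)) ⟩
      ⟦ s ⟧ * ∂ x a                         ≡⟨ cong (⟦ s ⟧ *_) (∂x a) ⟩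
      ⟦ s ⟧ * (⟦ s ⟧ * μ)                   ≡⟨ sym (ℤP.*-assoc ⟦ s ⟧ ⟦ s ⟧ μ) ⟩
      ⟦ s ⟧ * ⟦ s ⟧ * μ                     ≡⟨ cong (_* μ) (⟦⟧-square s) ⟩
      + 1 * μ                               ≡⟨ ℤP.*-identityˡ μ ⟩
      μ                                     ∎
      where open ≡-Reasoning
    0<μ : + 0 ℤ.< μ
    0<μ = ℤP.≤∧≢⇒< (δ-⟦⟧δ-nonneg t a b) (not-closed ∘ δ-⟦⟧δ≡0⇒closed t a b ∘ sym)
    positive : ∃ λ i → + 0 ℤ.< ⟦ s ⟧ * (Inc B i a * x i)
    positive = positive-term-of-positive-sum (λ i → ⟦ s ⟧ * (Inc B i a * x i))
                                             (subst (+ 0 ℤ.<_) (sym Σ≡μ) 0<μ)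

  wrap : {x : Vecℤ B} {s : Sign} {i : Fin n} {a a′ : Fin m} → src B i ≢ tgt B i → EndsAre B (fwd i) a a′ →
         Realisation x (s S.* σ B i) a′ a′ S.+ → Realisation x s a a S.+
  wrap {x} {s} {i} {a} {a′} link ends (ω , sgnW≡+ , inc≡x) = detour , sgnW-detour , inc-detour
    where
    back : Walk B a′ a
    back = (fwd i , swap ends) ∷ [] a
    detour : Walk B a a
    detour = (fwd i , ends) ∷ (ω ++ʷ back)
    σσ≡+ : ∀ σ′ → σ′ S.* (S.+ S.* (σ′ S.* S.+)) ≡ S.+
    σσ≡+ S.+ = refl
    σσ≡+ S.- = refl
    sgnW-detour : σ B i S.* sgnW (ω ++ʷ back) ≡ S.+
    sgnW-detour = trans (cong (σ B i S.*_) (trans (sgnW-++ ω back) (cong (S._* (σ B i S.* S.+)) sgnW≡+)))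
                        (σσ≡+ (σ B i))
    d d′ : ℤ
    d = dfun B a (fwd i)
    d′ = dfun B a′ (fwd i)
    back-inc : ∀ j → incFrom B ((s S.* σ B i) S.* sgnW ω) back j ≡ ⟦ s ⟧ * ⟦ σ B i ⟧ * d′ * δ i j
    back-inc j = trans (ℤP.+-identityʳ _) (cong (λ c → c * d′ * δ i j)
      (trans (cong (λ t → ⟦ (s S.* σ B i) S.* t ⟧) sgnW≡+)
      (trans (cong ⟦_⟧ (SP.*-identityʳ (s S.* σ B i))) (⟦⟧-* s (σ B i)))))
    inc-detour : ∀ j → incFrom B s detour j ≡ x j
    inc-detour j = begin
      ⟦ s ⟧ * d * δ i j + incFrom B (s S.* σ B i) (ω ++ʷ back) j
        ≡⟨ cong (_+_ (⟦ s ⟧ * d * δ i j)) (incFrom-++ (s S.* σ B i) ω back j) ⟩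
      ⟦ s ⟧ * d * δ i j + (incFrom B (s S.* σ B i) ω j + incFrom B ((s S.* σ B i) S.* sgnW ω) back j)
        ≡⟨ cong (_+_ (⟦ s ⟧ * d * δ i j)) (cong₂ _+_ (inc≡x j) (back-inc j)) ⟩
      ⟦ s ⟧ * d * δ i j + (x j + ⟦ s ⟧ * ⟦ σ B i ⟧ * d′ * δ i j)
        ≡⟨ collect (⟦ s ⟧) (⟦ σ B i ⟧) d d′ (δ i j) (x j) ⟩
      x j + ⟦ s ⟧ * (d + ⟦ σ B i ⟧ * d′) * δ i j
        ≡⟨ cong (λ e → x j + ⟦ s ⟧ * e * δ i j) (link-cancel link ends) ⟩
      x j + ⟦ s ⟧ * + 0 * δ i j
        ≡⟨ vanish (⟦ s ⟧) (δ i j) (x j) ⟩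
      x j ∎
      where
      open ≡-Reasoning
      collect : ∀ S σ′ e e′ D X → S * e * D + (X + S * σ′ * e′ * D) ≡ X + S * (e + σ′ * e′) * D
      collect = solve-∀
      vanish : ∀ S D X → X + S * + 0 * D ≡ X
      vanish = solve-∀

  -- Loops are skipped: going along a link and straight back adds nothing to the incidence vector
  -- (link-cancel), whereas going twice around a directed loop would.
  conjugate : {x : Vecℤ B} {a c : Fin m} → Reach B a c → (∀ s → Realisation x s c c S.+) →
              ∀ s → Realisation x s a a S.+
  conjugate (here _) R s = R s
  conjugate {x} (step i ends r) R s with src B i ≟ tgt B i
  ... | yes loop =
    subst (λ w → Realisation x s w w S.+) (proj₂ (proj₂ (loop-ends (fwd i) loop ends))) (conjugate r R s)
  ... | no link = wrap link ends (conjugate r R (s S.* σ B i))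

  null-realisation : {x : Vecℤ B} {s t : Sign} {a b : Fin m} → (∀ j → x j ≡ + 0) → HasBoundary x s a b t →
                     Realisation x s a b t
  null-realisation {x} {s} {t} {a} {b} x≗0 ∂x
    with δ-⟦⟧δ≡0⇒closed t a b (⟦⟧*y≡0⇒y≡0 s (trans (sym (∂x a)) (trans (∂-cong x≗0 a) (∂-zero a))))
  ... | refl , refl = [] a , refl , λ j → sym (x≗0 j)

  realise : Connected B → ∀ k x → ‖ x ‖₁ ≡ k → ∀ {s a b t} → HasBoundary x s a b t → Realisation x s a b t
  realise conn zero x ‖x‖≡0 ∂x = null-realisation (‖‖₁≡0⇒≗0 x ‖x‖≡0) ∂x
  realise conn (suc k) x ‖x‖≡1+k {s} {a} {b} {t} ∂x with b ≟ a ×-dec t S.≟ S.+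
  ... | no not-closed = descend (realise conn k) ‖x‖≡1+k ∂x (open-descent {x} {s} {t} not-closed ∂x)
  ... | yes (refl , refl) = conjugate (conn a (src B i)) closed-at-support s
    where
    support : ∃ λ i → x i ≢ + 0
    support = ‖‖₁-support x ‖x‖≡1+k
    i : Fin n
    i = proj₁ support
    ∂x≡0 : ∀ v → ∂ x v ≡ + 0
    ∂x≡0 v = trans (∂x v) (closed+-vanishes s a v)
    closed-at-support : ∀ s′ → Realisation x s′ (src B i) (src B i) S.+
    closed-at-support s′ = descend (realise conn k) ‖x‖≡1+k
      (λ v → trans (∂x≡0 v) (sym (closed+-vanishes s′ (src B i) v)))
      (descent-at-support i ∂x≡0 (proj₂ support) s′)

  realisation⇒PMInc : {x : Vecℤ B} {a b : Fin m} {s : Sign} (ω : Walk B a b) →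
                      (∀ j → incFrom B s ω j ≡ x j) → PMInc B ω x
  realisation⇒PMInc {s = S.+} ω inc≡x = inj₁ (λ j → sym (inc≡x j))
  realisation⇒PMInc {s = S.-} ω inc≡x = inj₂ (λ j → trans (sym (inc≡x j)) (incFrom-−≡-inc ω j))

  -- The parts of the theorem

  R₀⇒HasBoundary : (a : Fin m) (x : Vecℤ B) → Rq B 0 x → HasBoundary x S.+ a a S.+
  R₀⇒HasBoundary a x q₀ v =
    trans (sumSq≡0 (∂ x) (trans (sym (twoQ≡sumSq∂ x)) q₀) v) (sym (closed+-vanishes S.+ a v))

  two-point-boundary : (s t : Sign) (A C : ℤ) →
                       (s ◃ 1) * A + (t ◃ 1) * C ≡ ⟦ s ⟧ * (A - ⟦ S.opposite (s S.* t) ⟧ * C)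
  two-point-boundary S.+ S.+ = solve-∀
  two-point-boundary S.+ S.- = solve-∀
  two-point-boundary S.- S.+ = solve-∀
  two-point-boundary S.- S.- = solve-∀

  R₁⇒HasBoundary : (x : Vecℤ B) → Rq B 1 x →
                   ∃ λ a → ∃ λ b → a ≢ b × ∃ λ s → ∃ λ t → HasBoundary x s a b t
  R₁⇒HasBoundary x q₁ =
    let a , b , a≢b , s , t , ∂x≗ = sumSq≡2 (∂ x) (trans (sym (twoQ≡sumSq∂ x)) q₁)
    in a , b , a≢b , s , S.opposite (s S.* t) , λ v → trans (∂x≗ v) (two-point-boundary s t (δ a v) (δ b v))

  R₀⇒closed-even-walk : Connected B → Fin m → (x : Vecℤ B) → Rq B 0 x →
                        ∃[ v ] Σ (Walk B v v) λ ω → EvenBidir B ω × PMInc B ω x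
  R₀⇒closed-even-walk conn a x q₀ =
    let ω , sgnW≡+ , inc≡x = realise conn _ x refl {S.+} {a} {a} {S.+} (R₀⇒HasBoundary a x q₀)
    in a , ω , Equivalence.from (even⇔sgnW≡+ ω) sgnW≡+ , realisation⇒PMInc ω inc≡x

  R₁⇒open-walk : Connected B → (x : Vecℤ B) → Rq B 1 x →
                 ∃[ v ] ∃[ w ] v ≢ w × Σ (Walk B v w) λ ω → PMInc B ω x
  R₁⇒open-walk conn x q₁ =
    let a , b , a≢b , s , t , ∂x = R₁⇒HasBoundary x q₁
        ω , _ , inc≡x = realise conn _ x refl {s} {a} {b} {t} ∂x
    in a , b , a≢b , ω , realisation⇒PMInc ω inc≡x

  R₀∪R₁⊆Rinc : Connected B → Fin m → (x : Vecℤ B) → Rq B 0 x ⊎ Rq B 1 x → InRinc B x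
  R₀∪R₁⊆Rinc conn a x (inj₁ q₀) = let v , ω , _ , pm = R₀⇒closed-even-walk conn a x q₀ in v , v , ω , pm
  R₀∪R₁⊆Rinc conn a x (inj₂ q₁) = let v , w , _ , ω , pm = R₁⇒open-walk conn x q₁ in v , w , ω , pm

  Rinc⊆R₀∪R₁∪R₂ : (x : Vecℤ B) → InRinc B x → Rq B 0 x ⊎ Rq B 1 x ⊎ Rq B 2 x
  Rinc⊆R₀∪R₁∪R₂ x (_ , _ , ω , pm) with walk-classification ω pm
  ... | inj₁ (_ , q₁) = inj₂ (inj₁ q₁)
  ... | inj₂ (inj₁ (_ , _ , q₀)) = inj₁ q₀
  ... | inj₂ (inj₂ (_ , _ , q₂)) = inj₂ (inj₂ q₂)

  R₀⇔closed-even-walk : Connected B → Fin m → (x : Vecℤ B) →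
                        Rq B 0 x ⇔ (∃[ v ] Σ (Walk B v v) λ ω → EvenBidir B ω × PMInc B ω x)
  R₀⇔closed-even-walk conn a x = mk⇔ (R₀⇒closed-even-walk conn a x) λ where
    (_ , ω , even , pm) → case walk-classification ω pm of λ where
      (inj₁ (v≢v , _)) → contradiction refl v≢v
      (inj₂ (inj₁ (_ , _ , q₀))) → q₀
      (inj₂ (inj₂ (_ , odd , _))) → contradiction even odd

  R₁⇔open-walk : Connected B → (x : Vecℤ B) →
                 Rq B 1 x ⇔ (∃[ v ] ∃[ w ] v ≢ w × Σ (Walk B v w) λ ω → PMInc B ω x)
  R₁⇔open-walk conn x = mk⇔ (R₁⇒open-walk conn x) λ where
    (_ , _ , v≢w , ω , pm) → case walk-classification ω pm of λ where
      (inj₁ (_ , q₁)) → q₁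
      (inj₂ (inj₁ (v≡w , _))) → contradiction v≡w v≢w
      (inj₂ (inj₂ (v≡w , _))) → contradiction v≡w v≢w

  Rinc∩R₂⇔closed-odd-walk : (x : Vecℤ B) →
    (InRinc B x × Rq B 2 x) ⇔ (∃[ v ] Σ (Walk B v v) λ ω → ¬ EvenBidir B ω × PMInc B ω x)
  Rinc∩R₂⇔closed-odd-walk x = mk⇔
    (λ where ((v , _ , ω , pm) , q₂) → case walk-classification ω pm of λ where
               (inj₁ (_ , q₁)) → case Rq-unique 1 2 q₁ q₂ of λ ()
               (inj₂ (inj₁ (_ , _ , q₀))) → case Rq-unique 0 2 q₀ q₂ of λ ()
               (inj₂ (inj₂ (refl , odd , _))) → v , ω , odd , pm)
    (λ where (v , ω , odd , pm) → case walk-classification ω pm of λ where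
               (inj₁ (v≢v , _)) → contradiction refl v≢v
               (inj₂ (inj₁ (_ , even , _))) → contradiction even odd
               (inj₂ (inj₂ (_ , _ , q₂))) → (v , v , ω , pm) , q₂)

  R₀∪R₁≡Rinc⇔balanced : Connected B → Fin m →
    ((x : Vecℤ B) → (Rq B 0 x ⊎ Rq B 1 x) ⇔ InRinc B x) ⇔ Balanced B
  R₀∪R₁≡Rinc⇔balanced conn a = mk⇔ R₀∪R₁≡Rinc⇒balanced balanced⇒R₀∪R₁≡Rinc
    where
    R₀∪R₁≡Rinc⇒balanced : ((x : Vecℤ B) → (Rq B 0 x ⊎ Rq B 1 x) ⇔ InRinc B x) → Balanced B
    R₀∪R₁≡Rinc⇒balanced R₀∪R₁≡Rinc v ω with walk-classification ω (inj₁ λ _ → refl)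
      | Equivalence.from (R₀∪R₁≡Rinc (inc B ω)) (v , v , ω , inj₁ λ _ → refl)
    ... | inj₁ (v≢v , _) | _ = contradiction refl v≢v
    ... | inj₂ (inj₁ (_ , even , _)) | _ = even
    ... | inj₂ (inj₂ (_ , _ , q₂)) | inj₁ q₀ = case Rq-unique 0 2 q₀ q₂ of λ ()
    ... | inj₂ (inj₂ (_ , _ , q₂)) | inj₂ q₁ = case Rq-unique 1 2 q₁ q₂ of λ ()
    balanced⇒R₀∪R₁≡Rinc : Balanced B → (x : Vecℤ B) → (Rq B 0 x ⊎ Rq B 1 x) ⇔ InRinc B x
    balanced⇒R₀∪R₁≡Rinc balanced x = mk⇔ (R₀∪R₁⊆Rinc conn a x) λ where
      (v , _ , ω , pm) → case walk-classification ω pm of λ where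
        (inj₁ (_ , q₁)) → inj₂ q₁
        (inj₂ (inj₁ (_ , _ , q₀))) → inj₁ q₀
        (inj₂ (inj₂ (refl , odd , _))) → contradiction (balanced v ω) odd

theoremC : {m n : ℕ} → 0 < n → (B : BGraph m n) → Connected B →
    ((x : Vecℤ B) → (Rq B 0 x ⊎ Rq B 1 x) → InRinc B x)
    × ((x : Vecℤ B) → InRinc B x → Rq B 0 x ⊎ Rq B 1 x ⊎ Rq B 2 x)
    × ((x : Vecℤ B) → Rq B 0 x ⇔ (∃[ v ] Σ (Walk B v v) λ ω → EvenBidir B ω × PMInc B ω x))
    × ((x : Vecℤ B) → Rq B 1 x ⇔ (∃[ v ] ∃[ w ] v ≢ w × Σ (Walk B v w) λ ω → PMInc B ω x))
    × ((x : Vecℤ B) → (InRinc B x × Rq B 2 x) ⇔ (∃[ v ] Σ (Walk B v v) λ ω → ¬ EvenBidir B ω × PMInc B ω x))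
    × (((x : Vecℤ B) → (Rq B 0 x ⊎ Rq B 1 x) ⇔ InRinc B x) ⇔ Balanced B)
theoremC {m} 0<n B conn =
  R₀∪R₁⊆Rinc B conn a , Rinc⊆R₀∪R₁∪R₂ B , R₀⇔closed-even-walk B conn a , R₁⇔open-walk B conn ,
  Rinc∩R₂⇔closed-odd-walk B , R₀∪R₁≡Rinc⇔balanced B conn a
  where
  a : Fin m
  a = src B (Data.Fin.fromℕ< 0<n)
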